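{- Let $m\ge 2$ be an integer and let $P=(A_1,A_2,\dots,A_{m+1})$ be a cyclic $(m+1)$-gon (distinct vertices on a circle) with vertices ordered anticlockwise. Then \[ S_{1,m,m+1}\prod_{i=2}^{m-1} x_{i,m+1} = \sum_{j=1}^{m-1} S_{j,j+1,m+1}\, \frac{\prod_{k=1}^{m} x_{k,m+1}}{x_{j,m+1}\,x_{j+1,m+1}}. \]
   Context: For points $A_p=(x_p,y_p)$, $x_{pq}:=(x_q-x_p)^2+(y_q-y_p)^2$ is the squared distance between $A_p$ and $A_q$, and $S_{pqr}:=2[(x_q-x_p)(y_r-y_p)-(y_q-y_p)(x_r-x_p)]$ is four times the signed area of the triangle $A_pA_qA_r$. An empty product equals $1$. -}

module Defs where

open import Level using (_⊔_) renaming (suc to lsuc)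
open import Algebra.Apartness.Bundles using (HeytingField)
open import Algebra.Bundles using (CommutativeRing)
open import Data.Fin.Base as Fin using (Fin; fromℕ; inject₁)
open import Data.Fin.Properties using (fromℕ≢inject₁)
open import Data.Nat.Base as ℕ using (ℕ)
open import Data.Product.Base using (_,_; proj₁)
open import Data.Sum.Base using (_⊎_; inj₁; inj₂)
open import Data.Vec.Functional using (Vector)
open import Function.Base using (_∘_)
open import Relation.Binary.Core using (Rel)
open import Relation.Binary.PropositionalEquality.Core as ≡ using (_≢_)
open import Relation.Binary.Structures using (IsStrictPartialOrder)
import Algebra.Apartness.Properties.HeytingCommutativeRing as HCRProperties
import Algebra.Properties.Monoid.Sum as MonoidSum
import Algebra.Properties.Ring as RingProperties
import Relation.Binary.Reasoning.Setoid as SetoidReasoning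

-- Stands in for the real line, which the standard library does not have.
-- The apartness _#_ is "x < y or y < x".  The reals are an instance, both
-- classically (where _#_ is the negation of _≈_) and constructively, so
-- decidability of the order is not required.
record OrderedField c ℓ₁ ℓ₂ ℓ₃ : Set (lsuc (c ⊔ ℓ₁ ⊔ ℓ₂ ⊔ ℓ₃)) where
  field
    heytingField : HeytingField c ℓ₁ ℓ₂

  open HeytingField heytingField public

  infix 4 _<_
  field
    _<_                  : Rel Carrier ℓ₃
    isStrictPartialOrder : IsStrictPartialOrder _≈_ _<_
    #⇒<⊎>                : ∀ {x y} → x # y → x < y ⊎ y < x
    <⇒#                  : ∀ {x y} → x < y → x # y
    +-monoˡ-<            : ∀ z {x y} → x < y → x + z < y + z
    *-pos                : ∀ {x y} → 0# < x → 0# < y → 0# < x * y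

  open IsStrictPartialOrder isStrictPartialOrder public
    using (<-respˡ-≈; <-respʳ-≈)
    renaming (irrefl to <-irrefl; trans to <-trans)

  commutativeRing : CommutativeRing c ℓ₁
  commutativeRing = record { isCommutativeRing = isCommutativeRing }

module Plane {c ℓ₁ ℓ₂ ℓ₃} (K : OrderedField c ℓ₁ ℓ₂ ℓ₃) where

  open OrderedField K
  open CommutativeRing commutativeRing using (ring; +-monoid; *-monoid)
  open HCRProperties (HeytingField.heytingCommutativeRing heytingField)
    using (x-0≈x; x#0y#0→xy#0; invertibleˡ⇒#; invertibleʳ⇒#; #-congˡ; #-congʳ)
  open RingProperties ring using (-‿distribˡ-*; -‿distribʳ-*; -‿involutive)

  open MonoidSum +-monoid public using (sum-syntax)
  open MonoidSum *-monoid public using () renaming (sum to product)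

  infixl 10 product-syntax

  product-syntax : ∀ n → Vector Carrier n → Carrier
  product-syntax _ = product

  syntax product-syntax n (λ i → x) = ∏[ i < n ] x

  -- #⇒invertible yields an inverse of y - 0#, which is an inverse of y.
  infixl 7 _÷_[_]
  _÷_[_] : ∀ x y → y # 0# → Carrier
  x ÷ y [ y#0 ] = x * proj₁ (#⇒invertible y#0)

  record Point : Set c where
    constructor _,_
    field
      xc yc : Carrier

  open Point public

  infix 4 _#ₚ_
  _#ₚ_ : Rel Point ℓ₂
  p #ₚ q = xc p # xc q ⊎ yc p # yc q

  sqDist : Point → Point → Carrier
  sqDist p q = (xc q - xc p) * (xc q - xc p) + (yc q - yc p) * (yc q - yc p)

  S : Point → Point → Point → Carrier
  S p q r =
    (1# + 1#) * ((xc q - xc p) * (yc r - yc p) - (yc q - yc p) * (xc r - xc p))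

  record CyclicPolygon (N : ℕ) : Set (c ⊔ ℓ₁ ⊔ ℓ₂ ⊔ ℓ₃) where
    field
      vertex   : Fin N → Point
      distinct : ∀ {i j} → i ≢ j → vertex i #ₚ vertex j
      centre   : Point
      radius   : Carrier
      radius>0 : 0# < radius
      onCircle : ∀ i → sqDist centre (vertex i) ≈ radius * radius

  -- Points on a circle listed in anticlockwise order (a single turn): any
  -- three of them, taken in the order of the list, form an anticlockwise
  -- triangle, i.e. one of positive signed area.
  Anticlockwise : ∀ {N} → CyclicPolygon N → Set ℓ₃
  Anticlockwise P = ∀ {i j k} → i Fin.< j → j Fin.< k →
                    0# < S (vertex i) (vertex j) (vertex k)
    where open CyclicPolygon P

  private
    open module ≈-Reasoning = SetoidReasoning setoid

    0<x² : ∀ {x} → x # 0# → 0# < x * x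
    0<x² {x} x#0 with #⇒<⊎> x#0
    ... | inj₂ 0<x = *-pos 0<x 0<x
    ... | inj₁ x<0 = <-respʳ-≈ -x*-x≈x*x (*-pos 0<-x 0<-x)
      where
      0<-x : 0# < - x
      0<-x = <-respˡ-≈ (-‿inverseʳ x) (<-respʳ-≈ (+-identityˡ (- x)) (+-monoˡ-< (- x) x<0))

      -x*-x≈x*x : - x * - x ≈ x * x
      -x*-x≈x*x = begin
        - x * - x      ≈⟨ -‿distribˡ-* x (- x) ⟨
        - (x * - x)    ≈⟨ -‿cong (-‿distribʳ-* x x) ⟨
        - (- (x * x))  ≈⟨ -‿involutive (x * x) ⟩
        x * x          ∎

    x²#0⇒x#0 : ∀ {x} → x * x # 0# → x # 0#
    x²#0⇒x#0 {x} x²#0 with #⇒invertible x²#0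
    ... | y , _ , x²y≈1 = invertibleʳ⇒# (x * y , (begin
      (x - 0#) * (x * y)   ≈⟨ *-congʳ (x-0≈x x) ⟩
      x * (x * y)          ≈⟨ *-assoc x x y ⟨
      (x * x) * y          ≈⟨ *-congʳ (x-0≈x (x * x)) ⟨
      (x * x - 0#) * y     ≈⟨ x²y≈1 ⟩
      1#                   ∎))

    x#y⇒x-y#0 : ∀ {x y} → x # y → x - y # 0#
    x#y⇒x-y#0 {x} {y} x#y with #⇒invertible x#y
    ... | z , z[x-y]≈1 , _ = invertibleˡ⇒# (z , trans (*-congˡ (x-0≈x (x - y))) z[x-y]≈1)

    x²+y²#0 : ∀ {x y} → x # 0# → x * x + y * y # 0#
    x²+y²#0 {x} {y} x#0 with #-cotrans (x#0y#0→xy#0 x#0 x#0) (x * x + y * y)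
    ... | inj₂ z#0 = z#0
    ... | inj₁ x²#z = #-sym (<⇒# (<-trans (0<x² y#0)
            (<-respˡ-≈ (+-identityˡ (y * y)) (+-monoˡ-< (y * y) (0<x² x#0)))))
      where
      y#0 : y # 0#
      y#0 = x²#0⇒x#0 (#-congʳ (begin
        x * x + y * y - x * x    ≈⟨ +-congʳ (+-comm (x * x) (y * y)) ⟩
        y * y + x * x - x * x    ≈⟨ +-assoc (y * y) (x * x) (- (x * x)) ⟩
        y * y + (x * x - x * x)  ≈⟨ +-congˡ (-‿inverseʳ (x * x)) ⟩
        y * y + 0#               ≈⟨ +-identityʳ (y * y) ⟩
        y * y                    ∎) (x#y⇒x-y#0 (#-sym x²#z)))

  sqDist#0 : ∀ {p q} → p #ₚ q → sqDist p q # 0#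
  sqDist#0 (inj₁ x#x′) = x²+y²#0 (x#y⇒x-y#0 (#-sym x#x′))
  sqDist#0 (inj₂ y#y′) = #-congʳ (+-comm _ _) (x²+y²#0 (x#y⇒x-y#0 (#-sym y#y′)))

  -- x_{j,N} x_{k,N} is invertible for vertices A_j, A_k other than the last one A_N.
  denominator#0 : ∀ {n} (P : CyclicPolygon (ℕ.suc n)) (j k : Fin n) →
    let open CyclicPolygon P in
    sqDist (vertex (inject₁ j)) (vertex (fromℕ n)) *
    sqDist (vertex (inject₁ k)) (vertex (fromℕ n)) # 0#
  denominator#0 {n} P j k = x#0y#0→xy#0 (nonzero j) (nonzero k)
    where
    open CyclicPolygon P

    nonzero : ∀ i → sqDist (vertex (inject₁ i)) (vertex (fromℕ n)) # 0#
    nonzero i = sqDist#0 (distinct (fromℕ≢inject₁ ∘ ≡.sym))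

{-# OPTIONS --safe #-}

-- Inversion in a circle centred at the last vertex L takes the other vertices
-- to points of a line, so the triangles that L spans with their images have
-- additive signed areas.  The area for A_i , A_j is S_ij / (x_i x_j) up to a
-- constant.  Its additivity is the identity S_ij x_k + S_jk x_i = S_ik x_j,
-- where the circle enters only in making each x_p linear in A_p; the sum
-- then telescopes.
module Submission where

open import Defs
open import Algebra.Bundles using (CommutativeRing; RawRing)
open import Algebra.Solver.Ring.AlmostCommutativeRing
  using (fromCommutativeRing; _-Raw-AlmostCommutative⟶_)
open import Data.Fin.Base using (Fin; zero; suc; fromℕ; inject₁)
open import Data.Fin.Properties using (fromℕ≢inject₁)
open import Data.Maybe.Base using (Maybe; map)
open import Data.Nat.Base as ℕ using (ℕ)
open import Data.Product.Base as Prod using (_,_; proj₁; _×_)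
open import Function.Base using (_∘_)
open import Relation.Binary.PropositionalEquality.Core as ≡ using (_≡_)
open import Relation.Nullary.Decidable.Core using (dec⇒maybe)
import Algebra.Apartness.Properties.HeytingCommutativeRing as HCRProperties
import Algebra.Properties.AbelianGroup as AbelianGroupProperties
import Algebra.Properties.CommutativeSemigroup as CommutativeSemigroupProperties
import Algebra.Properties.Group as GroupProperties
import Algebra.Properties.Monoid.Sum as MonoidSum
import Algebra.Properties.Ring as RingProperties
import Algebra.Properties.Semiring.Mult as SemiringMult
import Algebra.Properties.Semiring.Sum as SemiringSum
import Algebra.Solver.Ring as RingSolver
import Data.Nat.Properties as ℕ
import Relation.Binary.Reasoning.Setoid as SetoidReasoning

-- Solving ring equations that involve cancellation needs coefficients with
-- decidable equality, which the ring itself lacks.  The coefficient (a , b)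
-- stands for the integer a - b.
module DifferenceSolver {c ℓ} (R : CommutativeRing c ℓ) where

  open CommutativeRing R
  open RingProperties ring using (x[y-z]≈xy-xz; [y-z]x≈yx-zx)
  open AbelianGroupProperties +-abelianGroup using ()
    renaming (⁻¹-∙-comm to -‿+-comm; ⁻¹-anti-homo‿- to -[a-b]≈b-a)
  open CommutativeSemigroupProperties +-commutativeSemigroup using (interchange)
  open SemiringMult semiring using (×-homo-+; ×1-homo-*) renaming (_×_ to _·_)
  open SetoidReasoning setoid

  ⟦_⟧ : ℕ × ℕ → Carrier
  ⟦ a , b ⟧ = a · 1# - b · 1#

  [a+c]-[b+d]≈[a-b]+[c-d] : ∀ a b c d → (a + c) - (b + d) ≈ (a - b) + (c - d)
  [a+c]-[b+d]≈[a-b]+[c-d] a b c d = begin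
    (a + c) - (b + d)        ≈⟨ +-congˡ (-‿+-comm b d) ⟨
    (a + c) + (- b + - d)    ≈⟨ interchange a c (- b) (- d) ⟩
    (a - b) + (c - d)        ∎

  -- The left side collects the positive and the negative products of two formal differences, as
  -- coefficient multiplication does.
  [ac+bd]-[ad+bc]≈[a-b][c-d] : ∀ a b c d →
    (a * c + b * d) - (a * d + b * c) ≈ (a - b) * (c - d)
  [ac+bd]-[ad+bc]≈[a-b][c-d] a b c d = begin
    (a * c + b * d) - (a * d + b * c)      ≈⟨ [a+c]-[b+d]≈[a-b]+[c-d] _ _ _ _ ⟩
    (a * c - a * d) + (b * d - b * c)      ≈⟨ +-congˡ (-[a-b]≈b-a _ _) ⟨
    (a * c - a * d) - (b * c - b * d)      ≈⟨ +-cong (x[y-z]≈xy-xz a c d) (-‿cong (x[y-z]≈xy-xz b c d)) ⟨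
    a * (c - d) - b * (c - d)              ≈⟨ [y-z]x≈yx-zx (c - d) a b ⟨
    (a - b) * (c - d)                      ∎

  a+d≈c+b⇒a-b≈c-d : ∀ {a b c d} → a + d ≈ c + b → a - b ≈ c - d
  a+d≈c+b⇒a-b≈c-d {a} {b} {c} {d} a+d≈c+b = begin
    a - b                ≈⟨ +-identityʳ _ ⟨
    -- Inserting `d - d` makes `a + d` appear for the hypothesis; the surplus `b - b` drops out
    -- afterwards.
    (a - b) + 0#         ≈⟨ +-congˡ (-‿inverseʳ d) ⟨
    (a - b) + (d - d)    ≈⟨ [a+c]-[b+d]≈[a-b]+[c-d] a b d d ⟨
    (a + d) - (b + d)    ≈⟨ +-cong a+d≈c+b (-‿cong (+-comm b d)) ⟩
    (c + b) - (d + b)    ≈⟨ [a+c]-[b+d]≈[a-b]+[c-d] c d b b ⟩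
    (c - d) + (b - b)    ≈⟨ +-congˡ (-‿inverseʳ b) ⟩
    (c - d) + 0#         ≈⟨ +-identityʳ _ ⟩
    c - d                ∎

  ℕ×ℕ-rawRing : RawRing _ _
  ℕ×ℕ-rawRing = record
    { Carrier = ℕ × ℕ
    ; _≈_     = _≡_
    ; _+_     = λ (a , b) (c , d) → a ℕ.+ c , b ℕ.+ d
    ; _*_     = λ (a , b) (c , d) → a ℕ.* c ℕ.+ b ℕ.* d , a ℕ.* d ℕ.+ b ℕ.* c
    ; -_      = Prod.swap
    ; 0#      = 0 , 0
    ; 1#      = 1 , 0
    }

  ·1-homo-*+* : ∀ a b c d → (a ℕ.* b ℕ.+ c ℕ.* d) · 1# ≈ (a · 1#) * (b · 1#) + (c · 1#) * (d · 1#)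
  ·1-homo-*+* a b c d = trans (×-homo-+ 1# (a ℕ.* b) (c ℕ.* d)) (+-cong (×1-homo-* a b) (×1-homo-* c d))

  homomorphism : ℕ×ℕ-rawRing -Raw-AlmostCommutative⟶ fromCommutativeRing R
  homomorphism = record
    { ⟦_⟧    = ⟦_⟧
    ; +-homo = λ (a , b) (c , d) →
        trans (+-cong (×-homo-+ 1# a c) (-‿cong (×-homo-+ 1# b d)))
              ([a+c]-[b+d]≈[a-b]+[c-d] _ _ _ _)
    ; *-homo = λ (a , b) (c , d) →
        trans (+-cong (·1-homo-*+* a c b d) (-‿cong (·1-homo-*+* a d b c)))
              ([ac+bd]-[ad+bc]≈[a-b][c-d] _ _ _ _)
    ; -‿homo = λ (a , b) → sym (-[a-b]≈b-a _ _)
    ; 0-homo = -‿inverseʳ 0#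
    ; 1-homo = trans (+-assoc 1# 0# (- 0#)) (trans (+-congˡ (-‿inverseʳ 0#)) (+-identityʳ 1#))
    }

  -- Pairs are never reduced, so cancellation can leave `(1 , 1)` for zero. Comparing cross sums
  -- recognises equal integers. A failed comparison refutes nothing, since distinct integers may
  -- agree in `R`.
  ⟦⟧-weaklyDecidable : ∀ p q → Maybe (⟦ p ⟧ ≈ ⟦ q ⟧)
  ⟦⟧-weaklyDecidable (a , b) (c , d) =
    map (λ a+d≡c+b → a+d≈c+b⇒a-b≈c-d (begin
          a · 1# + d · 1#    ≈⟨ ×-homo-+ 1# a d ⟨
          (a ℕ.+ d) · 1#     ≡⟨ ≡.cong (_· 1#) a+d≡c+b ⟩
          (c ℕ.+ b) · 1#     ≈⟨ ×-homo-+ 1# c b ⟩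
          c · 1# + b · 1#    ∎))
        (dec⇒maybe (a ℕ.+ d ℕ.≟ c ℕ.+ b))

  open RingSolver ℕ×ℕ-rawRing (fromCommutativeRing R) homomorphism ⟦⟧-weaklyDecidable public
    using (solve; _:=_; _:+_; _:*_; _:-_)

-- Telescoping sums and inverses in a commutative ring.

module _ {c ℓ} (R : CommutativeRing c ℓ) where

  open CommutativeRing R hiding (zero)
  open MonoidSum +-monoid using (sum)
  open DifferenceSolver R using (solve; _:=_; _:+_; _:*_)
  open SetoidReasoning setoid

  -- Induction from the front: the tail collapses to the step from index 1 to the last one, and
  -- additivity prepends the step from 0 to 1. The base case is a single step plus the empty sum.
  sum-telescope : ∀ n (t : Fin (2 ℕ.+ n) → Fin (2 ℕ.+ n) → Carrier) →
                  (∀ i j k → t i j + t j k ≈ t i k) →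
                  sum (λ (j : Fin (1 ℕ.+ n)) → t (inject₁ j) (suc j)) ≈ t zero (fromℕ (1 ℕ.+ n))
  sum-telescope ℕ.zero    t t-additive = +-identityʳ _
  sum-telescope (ℕ.suc n) t t-additive =
    trans (+-congˡ (sum-telescope n (λ i j → t (suc i) (suc j)) (λ _ _ _ → t-additive _ _ _)))
          (t-additive _ _ _)

  x*[y*z]≈x : ∀ x {y z} → y * z ≈ 1# → x * (y * z) ≈ x
  x*[y*z]≈x x yz≈1 = trans (*-congˡ yz≈1) (*-identityʳ x)

  -- Multiplying the hypothesis by `u * v * w`, the inverse of `x * y * z`, cancels one factor in
  -- each term.
  divide-three-term : ∀ {s t r x y z u v w} → x * u ≈ 1# → y * v ≈ 1# → z * w ≈ 1# →
                      s * z + t * x ≈ r * y → s * (u * v) + t * (v * w) ≈ r * (u * w)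
  divide-three-term {s} {t} {r} {x} {y} {z} {u} {v} {w} xu≈1 yv≈1 zw≈1 eq = begin
    s * (u * v) + t * (v * w)                          ≈⟨ +-cong (x*[y*z]≈x _ zw≈1) (x*[y*z]≈x _ xu≈1) ⟨
    s * (u * v) * (z * w) + t * (v * w) * (x * u)      ≈⟨ solve 7 (λ s t x z u v w →
                                                            s :* (u :* v) :* (z :* w) :+ t :* (v :* w) :* (x :* u)
                                                            := (s :* z :+ t :* x) :* (u :* v :* w)) refl s t x z u v w ⟩
    (s * z + t * x) * (u * v * w)                      ≈⟨ *-congʳ eq ⟩
    (r * y) * (u * v * w)                              ≈⟨ solve 5 (λ r y u v w →
                                                            (r :* y) :* (u :* v :* w) := r :* (u :* w) :* (y :* v))
                                                            refl r y u v w ⟩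
    r * (u * w) * (y * v)                              ≈⟨ x*[y*z]≈x _ yv≈1 ⟩
    r * (u * w)                                        ∎

  -- Uniqueness of inverses. It reconciles a quotient by a product with the separate inverses used
  -- for telescoping.
  inverse-of-product : ∀ {x y u v w} → x * u ≈ 1# → y * v ≈ 1# → w * (x * y) ≈ 1# → w ≈ u * v
  inverse-of-product {x} {y} {u} {v} {w} xu≈1 yv≈1 w[xy]≈1 = begin
    w                              ≈⟨ x*[y*z]≈x w xu≈1 ⟨
    w * (x * u)                    ≈⟨ x*[y*z]≈x _ yv≈1 ⟨
    w * (x * u) * (y * v)          ≈⟨ solve 5 (λ x y u v w →
                                        w :* (x :* u) :* (y :* v) := u :* v :* (w :* (x :* y)))
                                        refl x y u v w ⟩
    u * v * (w * (x * y))          ≈⟨ x*[y*z]≈x _ w[xy]≈1 ⟩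
    u * v                          ∎

-- Areas and distances from a point of a circle.

module _ {c ℓ₁ ℓ₂ ℓ₃} (K : OrderedField c ℓ₁ ℓ₂ ℓ₃) where

  open OrderedField K hiding (zero)
  open CommutativeRing commutativeRing using (+-group)
  open HCRProperties heytingCommutativeRing using (x-0≈x)
  open GroupProperties +-group using () renaming (∙-cancelʳ to +-cancelʳ)
  open Plane K
  open DifferenceSolver commutativeRing using (solve; _:=_; _:+_; _:*_; _:-_)
  open SetoidReasoning setoid

  -- For any points, |p - l|² + |o - l|² = 2 (o - l)·(p - l) + |p - o|²; on a circle about `o` the
  -- terms containing the radius cancel.
  sqDist-linear : ∀ o l p → sqDist o p ≈ sqDist o l →
    sqDist p l ≈ (xc o - xc l + (xc o - xc l)) * (xc p - xc l) +
                 (yc o - yc l + (yc o - yc l)) * (yc p - yc l)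
  sqDist-linear o l p op≈ol = +-cancelʳ (sqDist o l) _ _ (trans
    (solve 6 (λ o o′ l l′ p p′ →
        (l :- p) :* (l :- p) :+ (l′ :- p′) :* (l′ :- p′) :+
        ((l :- o) :* (l :- o) :+ (l′ :- o′) :* (l′ :- o′))
        := (o :- l :+ (o :- l)) :* (p :- l) :+ (o′ :- l′ :+ (o′ :- l′)) :* (p′ :- l′) :+
        ((p :- o) :* (p :- o) :+ (p′ :- o′) :* (p′ :- o′)))
      refl (xc o) (yc o) (xc l) (yc l) (xc p) (yc p))
    (+-congˡ op≈ol))

  -- `S p q l` is twice det(p - l, q - l). Plane vectors satisfy det(P,Q) R + det(Q,R) P = det(P,R)
  -- Q; the linear form with coefficients `a`, `b` is applied to this.
  S-linear-three-term : ∀ a b l p q r →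
    S p q l * (a * (xc r - xc l) + b * (yc r - yc l)) +
    S q r l * (a * (xc p - xc l) + b * (yc p - yc l))
    ≈ S p r l * (a * (xc q - xc l) + b * (yc q - yc l))
  S-linear-three-term a b l p q r =
    -- The factor `1# + 1#` can be an indeterminate: every term contains it exactly once.
    solve 11 (λ two a b l l′ p p′ q q′ r r′ →
        two :* ((q :- p) :* (l′ :- p′) :- (q′ :- p′) :* (l :- p)) :* (a :* (r :- l) :+ b :* (r′ :- l′)) :+
        two :* ((r :- q) :* (l′ :- q′) :- (r′ :- q′) :* (l :- q)) :* (a :* (p :- l) :+ b :* (p′ :- l′))
        := two :* ((r :- p) :* (l′ :- p′) :- (r′ :- p′) :* (l :- p)) :* (a :* (q :- l) :+ b :* (q′ :- l′)))
      refl (1# + 1#) a b (xc l) (yc l) (xc p) (yc p) (xc q) (yc q) (xc r) (yc r)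

  S-sqDist-three-term : ∀ o l {p q r} →
    sqDist o p ≈ sqDist o l → sqDist o q ≈ sqDist o l → sqDist o r ≈ sqDist o l →
    S p q l * sqDist r l + S q r l * sqDist p l ≈ S p r l * sqDist q l
  S-sqDist-three-term o l {p} {q} {r} op≈ol oq≈ol or≈ol = begin
    S p q l * sqDist r l + S q r l * sqDist p l  ≈⟨ +-cong (*-congˡ (sqDist-linear o l r or≈ol))
                                                          (*-congˡ (sqDist-linear o l p op≈ol)) ⟩
    -- The inferred coefficients are the doubled coordinates of `o - l`.
    _                                            ≈⟨ S-linear-three-term _ _ l p q r ⟩
    _                                            ≈⟨ *-congˡ (sqDist-linear o l q oq≈ol) ⟨
    S p r l * sqDist q l                         ∎

  #0⇒*-inverseˡ : ∀ {x} (x#0 : x # 0#) → proj₁ (#⇒invertible x#0) * x ≈ 1#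
  #0⇒*-inverseˡ {x} x#0 with #⇒invertible x#0
  ... | _ , inverseˡ , _ = trans (*-congˡ (sym (x-0≈x x))) inverseˡ

theorem2p9 : ∀ {c ℓ₁ ℓ₂ ℓ₃} (K : OrderedField c ℓ₁ ℓ₂ ℓ₃) →
  let open OrderedField K hiding (zero)
      open Plane K in
  ∀ (n : ℕ) →
  let m = 2 ℕ.+ n in
  ∀ (P : CyclicPolygon (1 ℕ.+ m)) → Anticlockwise P →
  let A = CyclicPolygon.vertex P
      L = A (fromℕ m) in
  S (A zero) (A (inject₁ (fromℕ (1 ℕ.+ n)))) L *
    (∏[ i < n ] sqDist (A (suc (inject₁ (inject₁ i)))) L)
  ≈
  (∑[ j < 1 ℕ.+ n ]
    (S (A (inject₁ (inject₁ j))) (A (inject₁ (suc j))) L *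
      ((∏[ k < m ] sqDist (A (inject₁ k)) L)
        ÷ (sqDist (A (inject₁ (inject₁ j))) L * sqDist (A (inject₁ (suc j))) L)
        [ denominator#0 P (inject₁ j) (suc j) ])))
theorem2p9 K n P _ = begin
  -- Two factors equal to 1 are inserted: `x zero` and `x last` complete `middle` to `X`, while
  -- their inverses turn `s zero last` into `t zero last`.
  s zero last * middle                                    ≈⟨ x*[y*z]≈x R _ (inverse last) ⟨
  s zero last * middle * (x last * u last)                ≈⟨ x*[y*z]≈x R _ (inverse zero) ⟨
  s zero last * middle * (x last * u last) * (x zero * u zero)
    ≈⟨ solve 6 (λ s m x y u v →
         s :* m :* (y :* v) :* (x :* u) := x :* (m :* y) :* (s :* (u :* v)))
         refl (s zero last) middle (x zero) (x last) (u zero) (u last) ⟩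
  -- The first factor of `X` splits off by computation, so only the last needs a lemma.
  x zero * (middle * x last) * t zero last                ≈⟨ *-congʳ (*-congˡ (product-init-last (x ∘ suc))) ⟨
  X * t zero last                                         ≈⟨ *-congˡ (sum-telescope R n t t-additive) ⟨
  X * sum (λ j → t (inject₁ j) (suc j))                   ≈⟨ *-distribˡ-sum X (λ j → t (inject₁ j) (suc j)) ⟩
  sum (λ j → X * t (inject₁ j) (suc j))                   ≈⟨ sum-cong-≋ summand ⟩
  _                                                       ∎
  where
  open OrderedField K hiding (zero)
  open Plane K
  open CyclicPolygon P
  open CommutativeRing commutativeRing using (semiring; *-monoid; *-commutativeSemigroup)
  open CommutativeSemigroupProperties *-commutativeSemigroup using (x∙yz≈y∙xz)
  open MonoidSum *-monoid using () renaming (sum-init-last to product-init-last)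
  open SemiringSum semiring using (sum; sum-cong-≋; *-distribˡ-sum)
  open DifferenceSolver commutativeRing using (solve; _:=_; _:*_)
  open SetoidReasoning setoid

  R = commutativeRing

  L : Point
  L = vertex (fromℕ (2 ℕ.+ n))

  last : Fin (2 ℕ.+ n)
  last = fromℕ (1 ℕ.+ n)

  -- Indices range over the vertices other than `L`, where `x` is invertible; counted from zero,
  -- `last` stands for A_m.
  x u : Fin (2 ℕ.+ n) → Carrier
  x i = sqDist (vertex (inject₁ i)) L

  x#0 : ∀ i → x i # 0#
  x#0 i = sqDist#0 (distinct (fromℕ≢inject₁ ∘ ≡.sym))

  u i = proj₁ (#⇒invertible (x#0 i))

  inverse : ∀ i → x i * u i ≈ 1#
  inverse i = trans (*-comm _ _) (#0⇒*-inverseˡ K (x#0 i))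

  s t : Fin (2 ℕ.+ n) → Fin (2 ℕ.+ n) → Carrier
  s i j = S (vertex (inject₁ i)) (vertex (inject₁ j)) L
  t i j = s i j * (u i * u j)

  X middle : Carrier
  X      = ∏[ k < 2 ℕ.+ n ] x k
  middle = ∏[ i < n ] x (suc (inject₁ i))

  equidistant : ∀ i → sqDist centre (vertex (inject₁ i)) ≈ sqDist centre L
  equidistant i = trans (onCircle _) (sym (onCircle _))

  t-additive : ∀ i j k → t i j + t j k ≈ t i k
  t-additive i j k = divide-three-term R (inverse i) (inverse j) (inverse k)
    (S-sqDist-three-term K centre L (equidistant i) (equidistant j) (equidistant k))

  summand : ∀ j → X * t (inject₁ j) (suc j) ≈
    s (inject₁ j) (suc j) * (X ÷ (x (inject₁ j) * x (suc j)) [ denominator#0 P (inject₁ j) (suc j) ])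
  summand j = trans (x∙yz≈y∙xz _ _ _) (*-congˡ (*-congˡ (sym
    (inverse-of-product R (inverse (inject₁ j)) (inverse (suc j))
      (#0⇒*-inverseˡ K (denominator#0 P (inject₁ j) (suc j)))))))
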